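{- Fix $m,\ell\in\mathbb{N}$. Let $\mathbb{N}=C_1\sqcup C_2$ be a partition of $\mathbb{N}$ into two disjoint sets. Then there exist $i\in\{1,2\}$ and an infinite set $B\subseteq\mathbb{N}$ such that $$(m+\ell)B\cup\{mx+\ell y:x,y\in B,\ x<y\}\subseteq C_i.$$
   Context: $\mathbb{N}=\{1,2,3,\ldots\}$. For $k\in\mathbb{N}$ and $B\subseteq\mathbb{N}$, $kB=\{kx:x\in B\}$ (dilation). -}

module Defs where

open import Data.Fin using (Fin; zero; suc)
open import Data.Nat using (ℕ; _+_; _*_; _<_)
open import Data.Product using (_×_; ∃-syntax)
open import Level using (0ℓ)
open import Relation.Binary.PropositionalEquality using (_≡_)
open import Relation.Unary using (Pred; _∈_; _∪_; _≐_; _⊥_)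

-- Sets of positive integers are predicates on the library's ℕ (which contains
-- 0) that are included in ℕ⁺.
ℕ⁺ : Pred ℕ 0ℓ
ℕ⁺ n = 0 < n

-- As with 'partition into two disjoint sets', a part may be empty.
-- (_⊥_ is disjointness of predicates.)
IsPartition : (Fin 2 → Pred ℕ 0ℓ) → Set
IsPartition C = (C zero ∪ C (suc zero)) ≐ ℕ⁺ × C zero ⊥ C (suc zero)

infixr 8 _·_

_·_ : ℕ → Pred ℕ 0ℓ → Pred ℕ 0ℓ
(k · B) n = ∃[ x ] x ∈ B × n ≡ k * x

OrderedSums : ℕ → ℕ → Pred ℕ 0ℓ → Pred ℕ 0ℓ
OrderedSums m ℓ B n =
  ∃[ x ] ∃[ y ] x ∈ B × y ∈ B × x < y × n ≡ m * x + ℓ * y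

{-# OPTIONS --safe #-}
module Submission where

-- Write n = m + ℓ, let χ record the colour of a number, and put κ x = χ (n x).
-- Call an increasing sequence u a solution if all χ (n (u k)) and all χ (m (u i)
-- + ℓ (u k)), i < k, have one common colour.  Since n (n x + o) and m (n x + o)
-- + ℓ (n z + o) are n times n x + o and n times m x + ℓ z + o, it is enough to
-- refute the following hypothesis, called avoid: for no increasing u, offset o
-- and colour c do all κ (n (u k) + o) and all κ (m (u i) + ℓ (u k) + o), i < k,
-- equal c.
--
-- Flipping.  By Ramsey's theorem every increasing u contains terms u i, u k with
-- i < k at which κ is negated: κ (c s + o) = not κ (c b + o) for c in {ℓ, m, n}
-- and all small o, where s = m (u i) + ℓ (u k) and b = n (u k); otherwise the
-- colours agree on a whole subsequence, which the pigeonhole principle turns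
-- into a monochromatic one (avoid′, flips, windows).  Hence if A y is a property
-- of κ near ℓ y, m y and n y, and B y is the same property of the negated
-- colouring, then along every increasing sequence A at s is equivalent to B at b
-- for some pair i < k, on a whole window around s and b (Opposite).
--
-- Runs.  Suppose that A and B are opposite in this sense, and that A holds on
-- arbitrarily long intervals arbitrarily far out.  Then a long interval of A
-- starting near ℓ v forces B on a long interval starting at n v (forced,
-- transport), so B also holds on long intervals; and the intervals of A of any
-- given large length recur with bounded gaps (syndetic-runs), since a long
-- stretch without them, just after the last of them, would give an increasing
-- sequence along which the equivalence fails.  So A and B hold together on
-- arbitrarily long intervals (no-overlap).  A first use of syndetic-runs:
-- arbitrarily far out there are arbitrarily long intervals of positions y such
-- that the word of length W that κ spells from ℓ y on recurs with bounded gaps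
-- at multiples of ℓ (syn-long).
--
-- Limit patterns.  By Hindman's theorem and diagonalisation there are y i = ℓ (q
-- i), with q i finite sums of one system and of its subsystems, such that κ read
-- from ℓ (y i), m (y i) and n (y i) on converges to sequences X, Z and U, letter
-- by letter.  Because the q i come from a finite sums set, Z (m (y i) + e) = Z e
-- for i ≥ e (Z-recurrent); because the system can be chosen so that m x lies
-- in the intervals of the previous paragraph for its large sums x, every initial
-- word of Z occurs in κ with bounded gaps at multiples of ℓ (Z-syn).
--
-- The contradiction.  For a sign ε, if X agrees with ε xor Z on the first W
-- letters from ℓ t on, and W is large, then U (n t) = not (ε xor Z (m t))
-- (ruled): otherwise take v = t + y i.  As W and i grow this gives an increasing
-- sequence along which κ (m (v i) + ℓ (v k)) = κ (n (v i)) for i < k, contrary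
-- to avoid.  For κ in place of the limits, the rule becomes a property RuleAt κ
-- of positions, which holds on long intervals after each far y i.  The opposite
-- property is the rule for the negated colouring, so by no-overlap the two hold
-- together on an interval long enough to contain a position at which κ spells
-- the beginning of Z.  There the rule for κ with ε = false says that κ (n y)
-- differs from κ (m y), and the rule for the negated colouring with ε = true
-- says that they are equal (rule-clash).

open import Defs
open import Axiom.ExcludedMiddle using (ExcludedMiddle)
open import Data.Fin using (Fin)
open import Data.Nat using (ℕ; _+_)
open import Data.Nat.InfinitelyOften using (Inf)
open import Data.Product using (_×_; ∃-syntax)
open import Level using (0ℓ)
open import Relation.Unary using (Pred; _∈_; _⊆_; _∪_)

open import Data.Bool using (Bool; true; false; not; _∧_; _xor_)
open import Data.Bool.Properties using (not-involutive; ¬-not; not-¬) renaming (_≟_ to _≟ᵇ_)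
open import Data.Empty using (⊥; ⊥-elim)
open import Data.Fin using (zero; suc)
open import Data.List using (List; []; _∷_; _++_; map)
import Data.List.Membership.Propositional as List
open import Data.List.Membership.Propositional.Properties using (∈-++⁻; ∈-++⁺ˡ; ∈-++⁺ʳ; ∈-map⁺; ∈-map⁻)
open import Data.List.Relation.Unary.Any using (here; there)
open import Data.Nat hiding (_≟_)
open import Data.Nat.DivMod using (m≡m%n+[m/n]*n; m%n<n; m/n*n≤m)
open import Data.Nat.Properties hiding (_≟_)
open import Data.Nat.Tactic.RingSolver using (solve-∀)
open import Data.Product using (_,_; Σ; proj₁; proj₂)
open import Data.Sum using (_⊎_; inj₁; inj₂)
open import Data.Vec using (Vec; []; _∷_)
open import Data.Vec.Properties using (∷-injectiveˡ; ∷-injectiveʳ)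
open import Function using (_∘_; id)
open import Relation.Binary.PropositionalEquality
open import Relation.Nullary using (¬_; yes; no; does)
open import Relation.Nullary.Decidable using (decidable-stable)

-- Increasing sequences

Increasing : (ℕ → ℕ) → Set
Increasing v = ∀ k → v k < v (suc k)

increasing-≤ : ∀ {v} → Increasing v → ∀ {i k} → i ≤ k → v i ≤ v k
increasing-≤ {v} inc {i} i≤k = subst (λ j → v i ≤ v j) (m+[n∸m]≡n i≤k) (go _)
  where
  go : ∀ d → v i ≤ v (i + d)
  go zero    = ≤-reflexive (cong v (sym (+-identityʳ i)))
  go (suc d) = ≤-trans (go d) (≤-trans (<⇒≤ (inc (i + d))) (≤-reflexive (cong v (sym (+-suc i d)))))

increasing-< : ∀ {v} → Increasing v → ∀ {i k} → i < k → v i < v k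
increasing-< inc i<k = <-≤-trans (inc _) (increasing-≤ inc i<k)

increasing-id≤ : ∀ {v} → Increasing v → ∀ k → k ≤ v k
increasing-id≤ inc zero    = z≤n
increasing-id≤ inc (suc k) = ≤-<-trans (increasing-id≤ inc k) (inc k)

increasing-∘ : ∀ {v w} → Increasing v → Increasing w → Increasing (v ∘ w)
increasing-∘ incv incw k = increasing-< incv (incw k)

-- Infinite pigeonhole principle and Ramsey theorem for pairs

module Classical (em : ExcludedMiddle 0ℓ) where

  abstract
    byContradiction : {P : Set} → ¬ ¬ P → P
    byContradiction = decidable-stable em

    ¬∀⇒∃¬ : {A : Set} {P : A → Set} → ¬ (∀ a → P a) → ∃[ a ] ¬ P a
    ¬∀⇒∃¬ ¬all = byContradiction λ ¬ex → ¬all λ a → byContradiction λ ¬p → ¬ex (a , ¬p)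

    ¬→⇒× : {P Q : Set} → ¬ (P → Q) → P × ¬ Q
    ¬→⇒× ¬f = byContradiction (λ ¬p → ¬f λ p → ⊥-elim (¬p (p , λ q → ¬f λ _ → q)))

    -- If each w has some v > w with P w v, and P w v is inherited by smaller w, then
    -- an increasing sequence can be built along which P holds for every pair i < k.
    chain : (P : ℕ → ℕ → Set) → (∀ {w w′ v} → w′ ≤ w → P w v → P w′ v) →
            (∀ w → ∃[ v ] w < v × P w v) →
            ∃[ v ] Increasing v × (∀ k → P 0 (v k)) × (∀ i k → i < k → P (v i) (v k))
    chain P anti step = v , inc , (λ { zero → anti z≤n (P-step 0) ; (suc k) → anti z≤n (P-step (v k)) }) ,
                        λ { i (suc k) i<k → anti (increasing-≤ inc (s≤s⁻¹ i<k)) (P-step (v k)) }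
      where
      v : ℕ → ℕ
      v zero    = proj₁ (step 0)
      v (suc k) = proj₁ (step (v k))
      P-step : ∀ w → P w (proj₁ (step w))
      P-step w = proj₂ (proj₂ (step w))
      inc : Increasing v
      inc k = proj₁ (proj₂ (step (v k)))

    pigeonhole : (f : ℕ → Bool) → ∃[ c ] ∃[ φ ] Increasing φ × (∀ k → f (φ k) ≡ c)
    pigeonhole f with em {∀ w → ∃[ v ] w < v × f v ≡ true}
    ... | yes often = let (v , inc , t , _) = chain (λ _ v → f v ≡ true) (λ _ p → p) often
                      in true , v , inc , t
    ... | no ¬often = let (w , ¬p) = ¬∀⇒∃¬ ¬often
                      in false , (λ k → suc w + k) , (λ k → +-monoʳ-< (suc w) (n<1+n k)) ,
                         λ k → ¬-not (λ e → ¬p (_ , m≤m+n (suc w) k , e))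

  module Ramsey (R : ℕ → ℕ → Bool) where

    -- The colour that R gives to infinitely many pairs of s 0 with later terms of s;
    -- pick lists such terms, and next s is the sequence of them.
    colour : (ℕ → ℕ) → Bool
    colour s = proj₁ (pigeonhole (λ k → R (s 0) (s (suc k))))

    pick : (ℕ → ℕ) → ℕ → ℕ
    pick s = proj₁ (proj₂ (pigeonhole (λ k → R (s 0) (s (suc k)))))

    next : (ℕ → ℕ) → ℕ → ℕ
    next s k = s (suc (pick s k))

    -- Taking the first term and passing to next, again and again, yields a sequence
    -- heads s on which the colour of a pair depends on its smaller member only; these
    -- colours are listed by colours s.
    heads : (ℕ → ℕ) → ℕ → ℕ
    heads s zero    = s 0
    heads s (suc k) = heads (next s) k

    colours : (ℕ → ℕ) → ℕ → Bool
    colours s zero    = colour s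
    colours s (suc k) = colours (next s) k

    next-increasing : ∀ {s} → Increasing s → Increasing (next s)
    next-increasing {s} inc k =
      increasing-< inc (s≤s (proj₁ (proj₂ (proj₂ (pigeonhole (λ k → R (s 0) (s (suc k)))))) k))

    heads-in : ∀ s k → ∃[ j ] heads s k ≡ s j
    heads-in s zero    = 0 , refl
    heads-in s (suc k) = let (j , e) = heads-in (next s) k in suc (pick s j) , e

    heads-colour : ∀ s {i k} → i < k → R (heads s i) (heads s k) ≡ colours s i
    heads-colour s {zero} {suc k} _ with heads-in (next s) k
    ... | j , e = trans (cong (R (s 0)) e)
                        (proj₂ (proj₂ (proj₂ (pigeonhole (λ k → R (s 0) (s (suc k)))))) j)
    heads-colour s {suc i} {suc k} i<k = heads-colour (next s) (s≤s⁻¹ i<k)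

    heads-increasing : ∀ {s} → Increasing s → Increasing (heads s)
    heads-increasing {s} inc zero with heads-in (next s) 0
    ... | j , e = subst (s 0 <_) (sym e) (increasing-< inc (s≤s z≤n))
    heads-increasing inc (suc k) = heads-increasing (next-increasing inc) k

    abstract
      ramsey : ∃[ c ] ∃[ φ ] Increasing φ × (∀ {i k} → i < k → R (φ i) (φ k) ≡ c)
      ramsey with pigeonhole (colours id)
      ... | c , ψ , incψ , e =
        c , heads id ∘ ψ , increasing-∘ (heads-increasing {id} n<1+n) incψ ,
        λ {i} i<k → trans (heads-colour id (increasing-< incψ i<k)) (e i)

  open Ramsey public using (ramsey)

-- Finite sums and Hindman's theorem

-- FS a x: x is the sum of a nonempty finite set of terms of a with distinct
-- indices.
data FS : (ℕ → ℕ) → ℕ → Set where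
  head : ∀ {a} → FS a (a 0)
  skip : ∀ {a x} → FS (a ∘ suc) x → FS a x
  add  : ∀ {a x} → FS (a ∘ suc) x → FS a (a 0 + x)

infix 4 _⊑_

-- a ⊑ b: every finite sum of a is a finite sum of b.
_⊑_ : (ℕ → ℕ) → (ℕ → ℕ) → Set
a ⊑ b = ∀ {x} → FS a x → FS b x

-- Beyond the indices used by a finite sum y lies a tail of a, all of whose sums
-- are sums of a and remain so when y is added.
after : ∀ {a y} → FS a y → ∃[ b ] ∀ {x} → FS b x → FS a x × FS a (y + x)
after {a} head = a ∘ suc , λ p → skip p , add p
after (skip p) = let (b , f) = after p in b , λ q → skip (proj₁ (f q)) , skip (proj₂ (f q))
after {a} (add {x = y} p) = let (b , f) = after p in b , λ q →
  skip (proj₁ (f q)) , subst (FS a) (sym (+-assoc (a 0) y _)) (add (proj₂ (f q)))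

∧-true : ∀ {a b} → a ∧ b ≡ true → a ≡ true × b ≡ true
∧-true {true} e = refl , e

true≢false : ∀ {b} → b ≡ true → b ≡ false → ⊥
true≢false refl ()

module Hindman (em : ExcludedMiddle 0ℓ) where
  open Classical em

  -- C meets the finite sums of every subsystem of t.  The colour classes below are
  -- Boolean functions; a class that is not full is missed by a whole subsystem, so
  -- Hindman's theorem amounts to finding a subsystem inside a full class.
  Full : (ℕ → Bool) → (ℕ → ℕ) → Set
  Full C t = ∀ t′ → t′ ⊑ t → ∃[ x ] FS t′ x × C x ≡ true

  -- The intersection of C with its translate by - d.
  both : (ℕ → Bool) → ℕ → ℕ → Bool
  both C d y = C y ∧ C (d + y)

  -- From t one can pass to t′ by taking out d: adding d keeps the sums of t′ among
  -- the sums of t, and C intersected with its translate is still full.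
  Step : (ℕ → Bool) → (ℕ → ℕ) → ℕ → (ℕ → ℕ) → Set
  Step C t d t′ = FS t d × (∀ {y} → FS t′ y → FS t y × FS t (d + y)) × Full (both C d) t′

  ¬Full⇒ : ∀ {C t} → ¬ Full C t → ∃[ t′ ] t′ ⊑ t × (∀ {x} → FS t′ x → C x ≡ false)
  ¬Full⇒ ¬full with ¬∀⇒∃¬ ¬full
  ... | t′ , ¬1 with em {t′ ⊑ _}
  ... | yes sub = t′ , sub , λ {x} p → ¬-not λ e → ¬1 λ _ → x , p , e
  ... | no ¬sub = ⊥-elim (¬1 λ sub → ⊥-elim (¬sub (λ {x} → sub {x})))

  module _ (C : ℕ → Bool) (t : ℕ → ℕ) (full : Full C t) where

    -- P lists the nonempty sums of the terms chosen so far, and a is the system from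
    -- which the later terms are taken: its sums, alone or added to one in P, are
    -- sums of t.  The empty sum is accounted for by the 0 in front of P.
    Prefix : List ℕ → (ℕ → ℕ) → Set
    Prefix P a = ∀ p → p List.∈ 0 ∷ P → ∀ {x} → FS a x → FS t (p + x)

    -- Every sum of a that uses a 0 and a later term lies in C, or does so after one of
    -- the sums in P is added.
    Covered : List ℕ → (ℕ → ℕ) → Set
    Covered P a = ∀ y → FS (a ∘ suc) y → ∃[ p ] p List.∈ 0 ∷ P × C (p + (a 0 + y)) ≡ true

    Uncovered : List ℕ → (ℕ → ℕ) → Set
    Uncovered P a = ∃[ y ] FS (a ∘ suc) y × (∀ p → p List.∈ 0 ∷ P → C (p + (a 0 + y)) ≡ false)

    -- If no system were covered, terms could be chosen one after the other so that
    -- none of their finite sums is in C, although C is full.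
    module _ (uncovered : ∀ P a → Prefix P a → Uncovered P a) where

      Config : Set
      Config = Σ (List ℕ) λ P → Σ (ℕ → ℕ) (Prefix P)

      -- The next term; neither it nor any of its sums with the listed sums is in C.
      first : Config → ℕ
      first (P , a , pre) = a 0 + proj₁ (uncovered P a pre)

      next : Config → Config
      next c@(P , a , pre) = P ++ map (_+ first c) (0 ∷ P) , proj₁ rest , pre′
        where
        rest : ∃[ b ] ∀ {x} → FS b x → FS a x × FS a (first c + x)
        rest = after (add (proj₁ (proj₂ (uncovered P a pre))))
        pre′ : Prefix (P ++ map (_+ first c) (0 ∷ P)) (proj₁ rest)
        pre′ p′ p∈ q with ∈-++⁻ (0 ∷ P) p∈
        ... | inj₁ p∈P = pre p′ p∈P (proj₁ (proj₂ rest q))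
        ... | inj₂ p∈′ with ∈-map⁻ (_+ first c) {xs = 0 ∷ P} p∈′
        ... | p , p∈P , refl = subst (FS t) (sym (+-assoc p (first c) _)) (pre p p∈P (proj₂ (proj₂ rest q)))

      -- The sequence of chosen terms.
      bs : Config → ℕ → ℕ
      bs c zero    = first c
      bs c (suc k) = bs (next c) k

      avoids : ∀ c {p} → p List.∈ 0 ∷ proj₁ c → ∀ {a x} → FS a x → a ≡ bs c →
               FS t (p + x) × C (p + x) ≡ false
      avoids (P , a , pre) {p} p∈P head refl =
        let (y , fs , none) = uncovered P a pre in pre p p∈P (add fs) , none p p∈P
      avoids c p∈P (skip q) refl = avoids (next c) (∈-++⁺ˡ p∈P) q refl
      avoids c@(P , _) {p} p∈P (add {x = x} q) refl =
        subst (λ z → FS t z × C z ≡ false) (+-assoc p (first c) x)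
          (avoids (next c) (∈-++⁺ʳ (0 ∷ P) (∈-map⁺ (_+ first c) p∈P)) q refl)

      impossible : ⊥
      impossible =
        let c = [] , t , (λ { _ (here refl) q → q ; _ (there ()) })
            (x , fs , yes!) = full (bs c) (λ q → proj₁ (avoids c (here refl) q refl))
        in true≢false yes! (proj₂ (avoids c (here refl) fs refl))

    cover : Σ (List ℕ) λ P → Σ (ℕ → ℕ) λ a → Prefix P a × Covered P a
    cover = byContradiction λ ¬cov → impossible λ P a pre →
      byContradiction λ none → ¬cov (P , a , pre , λ y fs →
        byContradiction λ miss → none (y , fs , λ p p∈P → ¬-not λ e → miss (p , p∈P , e)))

    -- Either some d in D makes the intersection of C with its translate full on a
    -- subsystem of s, or some subsystem of s has no finite sum x such that x and
    -- d + x are both in C for some d in D.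
    sift : ∀ D s → (∃[ d ] d List.∈ D × ∃[ t′ ] t′ ⊑ s × Full (both C d) t′) ⊎
                   (∃[ t′ ] t′ ⊑ s × (∀ {d} → d List.∈ D → ∀ {x} → FS t′ x → both C d x ≡ false))
    sift [] s = inj₂ (s , id , λ ())
    sift (d ∷ D) s with em {Full (both C d) s}
    ... | yes full-d = inj₁ (d , here refl , s , id , full-d)
    ... | no ¬full-d with ¬Full⇒ ¬full-d
    ... | s′ , s′⊑s , none with sift D s′
    ... | inj₁ (d′ , d′∈ , t′ , sub , f) = inj₁ (d′ , there d′∈ , t′ , s′⊑s ∘ sub , f)
    ... | inj₂ (t′ , sub , none′) =
      inj₂ (t′ , s′⊑s ∘ sub , λ { (here refl) q → none (sub q) ; (there d∈) q → none′ d∈ q })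

    -- The finitely many candidates for the step are the numbers p + a 0, for p a sum
    -- listed by a covered system.  If none worked, C would miss, by covering, every
    -- sum of a subsystem.
    shift : ∃[ d ] ∃[ t′ ] Step C t d t′
    shift with cover
    ... | P , a , pre , cov with sift (map (_+ a 0) (0 ∷ P)) (a ∘ suc)
    ... | inj₁ (d , d∈ , t′ , sub , f) with ∈-map⁻ (_+ a 0) d∈
    ... | p , p∈P , refl =
      d , t′ , pre p p∈P head ,
      (λ {y} q → pre 0 (here refl) (skip (sub q)) ,
                 subst (FS t) (sym (+-assoc p (a 0) y)) (pre p p∈P (add (sub q)))) , f
    shift | P , a , pre , cov | inj₂ (t′ , sub , none) with full t′ (λ q → pre 0 (here refl) (skip (sub q)))
    ... | x , fs , Cx with cov x (sub fs)
    ... | p , p∈P , e =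
      ⊥-elim (true≢false (cong₂ _∧_ Cx (trans (cong C (+-assoc p (a 0) x)) e))
                         (none (∈-map⁺ (_+ a 0) p∈P) fs))

  -- A colour class together with a system on which it is full.
  State : Set
  State = Σ (ℕ → Bool) λ C → Σ (ℕ → ℕ) (Full C)

  _∋_ : State → ℕ → Set
  (C , _) ∋ x = C x ≡ true

  shift-by : State → ℕ
  shift-by (C , t , f) = proj₁ (shift C t f)

  shifted : State → State
  shifted (C , t , f) = let (d , t′ , _ , _ , f′) = shift C t f in both C d , t′ , f′

  -- The numbers taken out when steps are iterated.
  shifts : State → ℕ → ℕ
  shifts s zero    = shift-by s
  shifts s (suc k) = shifts (shifted s) k

  shifts-FS : ∀ s {a x} → FS a x → a ≡ shifts s → FS (proj₁ (proj₂ s)) x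
  shifts-FS (C , t , f) head refl = proj₁ (proj₂ (proj₂ (shift C t f)))
  shifts-FS s@(C , t , f) (skip q) refl =
    proj₁ (proj₁ (proj₂ (proj₂ (proj₂ (shift C t f)))) (shifts-FS (shifted s) q refl))
  shifts-FS s@(C , t , f) (add q) refl =
    proj₂ (proj₁ (proj₂ (proj₂ (proj₂ (shift C t f)))) (shifts-FS (shifted s) q refl))

  -- For each finite sum x of these numbers, a later class is contained both in the
  -- class of s and in its translate by - x.
  reach : ∀ s {a x} → FS a x → a ≡ shifts s → ∃[ s′ ] ∀ {y} → s′ ∋ y → s ∋ y × s ∋ (x + y)
  reach s head refl = shifted s , ∧-true
  reach s (skip q) refl =
    let (s′ , g) = reach (shifted s) q refl
    in s′ , λ y∈ → proj₁ (∧-true (proj₁ (g y∈))) , proj₁ (∧-true (proj₂ (g y∈)))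
  reach s@(C , _) (add {x = x} q) refl =
    let (s′ , g) = reach (shifted s) q refl
    in s′ , λ {y} y∈ → proj₁ (∧-true (proj₁ (g y∈))) ,
                       trans (cong C (+-assoc (shift-by s) x y)) (proj₂ (∧-true (proj₂ (g y∈))))

  -- The shifts need not lie in the class, but the class is full, so some finite sum
  -- e of them does; e can then serve as a step that belongs to the class.
  member : ∀ s → ∃[ e ] s ∋ e × ∃[ s′ ] (∀ {y} → s′ ∋ y → s ∋ y × s ∋ (e + y))
  member s@(C , t , f) =
    let (e , fs , Ce) = f (shifts s) (λ q → shifts-FS s q refl) in e , Ce , reach s fs refl

  members : State → ℕ → ℕ
  members s zero    = proj₁ (member s)
  members s (suc k) = members (proj₁ (proj₂ (proj₂ (member s)))) k

  members-in : ∀ s {a x} → FS a x → a ≡ members s → s ∋ x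
  members-in s head refl = proj₁ (proj₂ (member s))
  members-in s (skip q) refl = let (_ , _ , s′ , g) = member s in proj₁ (g (members-in s′ q refl))
  members-in s (add q) refl  = let (_ , _ , s′ , g) = member s in proj₂ (g (members-in s′ q refl))

  abstract
    -- The class that is tried is the set of sums of t with colour true.  If it is full,
    -- the members form a subsystem inside it; if not, a subsystem misses it.
    hindman : (f : ℕ → Bool) (t : ℕ → ℕ) → ∃[ c ] ∃[ t′ ] t′ ⊑ t × (∀ {x} → FS t′ x → f x ≡ c)
    hindman f t with em {Full (λ x → f x ∧ does (em {FS t x})) t}
    ... | no ¬full with ¬Full⇒ ¬full
    ... | t′ , sub , none = false , t′ , sub , λ {x} q → only (sub q) (none q)
      where
      only : ∀ {x} → FS t x → f x ∧ does (em {FS t x}) ≡ false → f x ≡ false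
      only {x} p e with f x | em {FS t x}
      ... | false | _      = refl
      ... | true  | no ¬p  = ⊥-elim (¬p p)
      only p () | true | yes _
    hindman f t | yes full = true , members s , (λ q → inside (members-in s q refl)) ,
                             λ q → proj₁ (∧-true (members-in s q refl))
      where
      s : State
      s = (λ x → f x ∧ does (em {FS t x})) , t , full
      inside : ∀ {x} → f x ∧ does (em {FS t x}) ≡ true → FS t x
      inside {x} e with em {FS t x} | proj₂ (∧-true {f x} e)
      ... | yes p | _ = p
      inside e | no _ | ()

-- Pairs at which the colouring flips

module Averages (em : ExcludedMiddle 0ℓ) (m ℓ : ℕ) .{{_ : NonZero m}} .{{_ : NonZero ℓ}} (κ : ℕ → Bool)
  (avoid : ∀ u → Increasing u → ∀ o c → (∀ k → κ ((m + ℓ) * u k + o) ≡ c) →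
           (∀ i k → i < k → κ (m * u i + ℓ * u k + o) ≡ c) → ⊥) where

  open Classical em

  n : ℕ
  n = m + ℓ

  abstract
    -- Along no sequence does every s = m (u i) + ℓ (u k) share its colour, after
    -- dilation by c and translation by o, with n (u k): the sequence c u, thinned so
    -- that its own colours are constant, would contradict avoid.
    avoid′ : ∀ u → Increasing u → ∀ c → .{{_ : NonZero c}} → ∀ o →
             (∀ i k → i < k → κ (c * (m * u i + ℓ * u k) + o) ≡ κ (c * (n * u k) + o)) → ⊥
    avoid′ u inc c o same with pigeonhole (λ k → κ (c * (n * u k) + o))
    ... | b , φ , incφ , e =
      avoid (λ k → c * u (φ k)) (λ k → *-monoʳ-< c (increasing-< inc (incφ k))) o b
        (λ k → trans (cong (λ x → κ (x + o)) (swap n c (u (φ k)))) (e k))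
        (λ i k i<k → trans (cong (λ x → κ (x + o)) (distr c (u (φ i)) (u (φ k))))
                       (trans (same _ _ (increasing-< incφ i<k)) (e k)))
      where
      swap : ∀ a b c → a * (b * c) ≡ b * (a * c)
      swap = solve-∀
      distr′ : ∀ m ℓ c x y → m * (c * x) + ℓ * (c * y) ≡ c * (m * x + ℓ * y)
      distr′ = solve-∀
      distr : ∀ c x y → m * (c * x) + ℓ * (c * y) ≡ c * (m * x + ℓ * y)
      distr = distr′ m ℓ

  -- After dilation by c and translation by o, the colours of m x + ℓ y and of n y
  -- differ.
  Flip : ℕ → ℕ → ℕ → ℕ → Set
  Flip c o x y = κ (c * (m * x + ℓ * y) + o) ≡ not (κ (c * (n * y) + o))

  abstract
    thin : ∀ u → Increasing u → ∀ c → .{{_ : NonZero c}} → ∀ o →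
           ∃[ φ ] Increasing φ × (∀ {i k} → i < k → Flip c o (u (φ i)) (u (φ k)))
    thin u inc c o with ramsey (λ i k → does (κ (c * (m * u i + ℓ * u k) + o) ≟ᵇ κ (c * (n * u k) + o)))
    ... | true  , φ , incφ , e = ⊥-elim (avoid′ (u ∘ φ) (increasing-∘ inc incφ) c o λ i k i<k → reflect (e i<k))
      where
      reflect : ∀ {a b} → does (a ≟ᵇ b) ≡ true → a ≡ b
      reflect {a} {b} e with a ≟ᵇ b
      ... | yes p = p
      reflect {a} {b} () | no _
    ... | false , φ , incφ , e = φ , incφ , λ i<k → reflect (e i<k)
      where
      reflect : ∀ {a b} → does (a ≟ᵇ b) ≡ false → a ≡ not b
      reflect {a} {b} e with a ≟ᵇ b
      ... | no ¬p = ¬-not ¬p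
      reflect {a} {b} () | yes _

  abstract
    thins : ∀ u → Increasing u → ∀ c → .{{_ : NonZero c}} → ∀ O →
            ∃[ φ ] Increasing φ × (∀ {i k} → i < k → ∀ o → o < O → Flip c o (u (φ i)) (u (φ k)))
    thins u inc c zero    = id , n<1+n , λ _ _ ()
    thins u inc c (suc O) with thins u inc c O
    ... | φ , incφ , f with thin (u ∘ φ) (increasing-∘ inc incφ) c O
    ... | ψ , incψ , g = φ ∘ ψ , increasing-∘ incφ incψ , λ i<k o o≤O → last i<k o (m≤n⇒m<n∨m≡n (s≤s⁻¹ o≤O))
      where
      last : ∀ {i k} → i < k → ∀ o → o < O ⊎ o ≡ O → Flip c o (u (φ (ψ i))) (u (φ (ψ k)))
      last i<k o (inj₁ o<O)  = f (increasing-< incψ i<k) o o<O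
      last i<k o (inj₂ refl) = g i<k

  instance
    n≢0 : NonZero n
    n≢0 = >-nonZero (<-≤-trans (>-nonZero⁻¹ m) (m≤m+n m ℓ))

  Flips : ℕ → ℕ → ℕ → Set
  Flips O x y = ∀ o → o < O → Flip ℓ o x y × Flip m o x y × Flip n o x y

  abstract
    -- All these flips occur simultaneously at one pair of terms.
    flips : ∀ u → Increasing u → ∀ O → ∃[ i ] ∃[ k ] i < k × Flips O (u i) (u k)
    flips u inc O with thins u inc ℓ O
    ... | φ , incφ , f with thins (u ∘ φ) (increasing-∘ inc incφ) m O
    ... | ψ , incψ , g with thins (u ∘ φ ∘ ψ) (increasing-∘ inc (increasing-∘ incφ incψ)) n O
    ... | χ , incχ , h =
      _ , _ , increasing-< (increasing-∘ incφ (increasing-∘ incψ incχ)) {0} {1} (s≤s z≤n) ,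
      λ o o<O → f (increasing-< (increasing-∘ incψ incχ) (s≤s z≤n)) o o<O ,
                g (increasing-< incχ (s≤s z≤n)) o o<O , h (s≤s z≤n) o o<O

  abstract
    -- The first multiple of d beyond a.
    above : ∀ d → .{{_ : NonZero d}} → ∀ a → ∃[ v ] a < d * v × d * v ≤ a + d
    above d a = suc (a / d) , lt , le
      where
      open ≤-Reasoning
      lt : a < d * suc (a / d)
      lt = begin-strict
        a                        ≡⟨ m≡m%n+[m/n]*n a d ⟩
        a % d + (a / d) * d      <⟨ +-monoˡ-< _ (m%n<n a d) ⟩
        d + (a / d) * d          ≡⟨ *-comm (suc (a / d)) d ⟩
        d * suc (a / d)          ∎
      le : d * suc (a / d) ≤ a + d
      le = begin
        d * suc (a / d)          ≡⟨ *-comm d (suc (a / d)) ⟩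
        d + (a / d) * d          ≤⟨ +-monoʳ-≤ d (m/n*n≤m a d) ⟩
        d + a                    ≡⟨ +-comm d a ⟩
        a + d                    ∎

  above-big : ∀ {a v N} → a < ℓ * v → ℓ * N ≤ a → N < v
  above-big {a} {v} {N} a< N≤ = *-cancelˡ-< ℓ N v (≤-<-trans N≤ a<)

  -- Runs of a property and of its opposite

  -- A holds throughout the interval from a to a + L, both ends included.
  Run : (ℕ → Set) → ℕ → ℕ → Set
  Run A L a = ∀ e → e ≤ L → A (a + e)

  -- A holds on arbitrarily long intervals arbitrarily far out.
  Long : (ℕ → Set) → Set
  Long A = ∀ L N → ∃[ a ] N ≤ a × Run A L a

  -- P holds somewhere on every interval of some fixed length.
  Syndetic : (ℕ → Set) → Set
  Syndetic P = ∃[ G ] ∀ x → ∃[ t ] t ≤ G × P (x + t)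

  -- Along every increasing u, at some pair i < k, A near m (u i) + ℓ (u k) is
  -- equivalent to B near n (u k).  In the applications A is a property of κ and B is
  -- the same property of its negation.
  Opposite : (ℕ → Set) → (ℕ → Set) → Set
  Opposite A B = ∀ u → Increasing u → ∀ L →
    ∃[ i ] ∃[ k ] i < k × (∀ e → e ≤ L → (A (m * u i + ℓ * u k + e) → B (n * u k + e)) ×
                                          (B (n * u k + e) → A (m * u i + ℓ * u k + e)))

  module _ {A B : ℕ → Set} (opp : Opposite A B) where

    abstract
      -- A long run of A at ℓ v + j forces B at n v + j.  Otherwise there are
      -- counterexamples v k whose runs are longer than m (v i) for all i < k; then A
      -- holds at m (v i) + ℓ (v k) + j but B fails at n (v k) + j, contrary to Opposite.
      forced : ∃[ K ] ∀ v j → K ≤ v → j < n → Run A K (ℓ * v + j) → B (n * v + j)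
      forced with em {∃[ K ] ∀ v j → K ≤ v → j < n → Run A K (ℓ * v + j) → B (n * v + j)}
      ... | yes p = p
      ... | no ¬p = ⊥-elim absurd
        where
        P : ℕ → ℕ → Set
        P w v = ∃[ j ] j < n × Run A (m * w) (ℓ * v + j) × ¬ B (n * v + j)

        step : ∀ w → ∃[ v ] w < v × P w v
        step w with ¬∀⇒∃¬ (λ q → ¬p (suc w + m * w , q))
        ... | v , ¬1 with ¬∀⇒∃¬ ¬1
        ... | j , ¬2 with ¬→⇒× ¬2
        ... | K≤v , ¬3 with ¬→⇒× ¬3
        ... | j<n , ¬4 with ¬→⇒× ¬4
        ... | run , ¬B = v , ≤-trans (m≤m+n (suc w) (m * w)) K≤v , j , j<n ,
                         (λ e e≤ → run e (≤-trans e≤ (m≤n+m (m * w) (suc w)))) , ¬B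

        anti : ∀ {w w′ v} → w′ ≤ w → P w v → P w′ v
        anti w′≤w (j , j<n , run , ¬B) = j , j<n , (λ e e≤ → run e (≤-trans e≤ (*-monoʳ-≤ m w′≤w))) , ¬B

        absurd : ⊥
        absurd with chain P anti step
        ... | v , inc , _ , pair with opp v inc n
        ... | i , k , i<k , same with pair i k i<k
        ... | j , j<n , run , ¬B =
          ¬B (proj₁ (same j (<⇒≤ j<n)) (subst A (shuffle (m * v i) (ℓ * v k) j) (run (m * v i) ≤-refl)))
          where
          shuffle : ∀ a b c → b + c + a ≡ a + b + c
          shuffle = solve-∀

    K : ℕ
    K = proj₁ forced

    -- The loss when a run is transported: ℓ for rounding up to a multiple of ℓ, n for
    -- the remainder j, and K for the run that forces a single value.
    H : ℕ
    H = ℓ + n + K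

    split : ∀ e → ∃[ q ] ∃[ r ] r < n × e ≡ n * q + r
    split e = e / n , e % n , m%n<n e n , trans (m≡m%n+[m/n]*n e n) (trans (+-comm (e % n) _) (cong (_+ e % n) (*-comm (e / n) n)))

    abstract
      -- A run of A at a becomes a run of B at n v, where ℓ v is the first multiple of ℓ
      -- from a on.  Its length is stretched by about n / ℓ: the offset n q + r of B is
      -- forced by the run of A at ℓ (v + q) + r.
      transport : ∀ a v {L L′} → a ≤ ℓ * v → ℓ * v ≤ a + ℓ → K ≤ v →
                  (∀ q → n * q ≤ L → ℓ * q + H ≤ L′) → Run A L′ a → Run B L (n * v)
      transport a v {L} {L′} a≤ ≤a K≤v fits run e e≤L with split e
      ... | q , r , r<n , refl =
        subst B (regroup′ n v q r) (proj₂ forced (v + q) r (≤-trans K≤v (m≤m+n v q)) r<n sub)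
        where
        regroup′ : ∀ n v q r → n * (v + q) + r ≡ n * v + (n * q + r)
        regroup′ = solve-∀
        sub : Run A K (ℓ * (v + q) + r)
        sub e e≤K = subst A (m+[n∸m]≡n lower) (run _ (+-cancelˡ-≤ a _ _ (≤-trans (≤-reflexive (m+[n∸m]≡n lower)) upper)))
          where
          x : ℕ
          x = ℓ * (v + q) + r + e
          lower : a ≤ x
          lower = ≤-trans a≤ (≤-trans (*-monoʳ-≤ ℓ (m≤m+n v q)) (≤-trans (m≤m+n _ r) (m≤m+n _ e)))
          upper : x ≤ a + L′
          upper = begin
            ℓ * (v + q) + r + e      ≡⟨ re ℓ v q r e ⟩
            ℓ * v + (ℓ * q + (r + e)) ≤⟨ +-mono-≤ ≤a (+-monoʳ-≤ (ℓ * q) (+-mono-≤ (<⇒≤ r<n) e≤K)) ⟩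
            a + ℓ + (ℓ * q + (n + K)) ≡⟨ re₂ a ℓ (ℓ * q) n K ⟩
            a + (ℓ * q + H)           ≤⟨ +-monoʳ-≤ a (fits q (≤-trans (m≤m+n (n * q) r) e≤L)) ⟩
            a + L′                    ∎
            where
            open ≤-Reasoning
            re : ∀ ℓ v q r e → ℓ * (v + q) + r + e ≡ ℓ * v + (ℓ * q + (r + e))
            re = solve-∀
            re₂ : ∀ a ℓ x n K → a + ℓ + (x + (n + K)) ≡ a + (x + (ℓ + n + K))
            re₂ = solve-∀

    abstract
      long-opposite : Long A → Long B
      long-opposite long L N with long (L + H) (ℓ * (N + K))
      ... | a , a≥ , run with above ℓ a
      ... | v , a< , ≤a =
        n * v , ≤-trans (≤-trans (m≤m+n N K) (<⇒≤ big)) (m≤n*m v n) ,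
        transport a v (<⇒≤ a<) ≤a (≤-trans (m≤n+m K N) (<⇒≤ big))
          (λ q nq≤L → +-monoˡ-≤ H (≤-trans (*-monoˡ-≤ q (m≤n+m ℓ m)) nq≤L)) run
        where
        big : N + K < v
        big = above-big a< a≥

    abstract
      -- The last number up to a + d that has P, given that a has it.
      last-before : (P : ℕ → Set) → ∀ a d → P a → ∃[ b ] a ≤ b × b ≤ a + d × P b × (∀ c → b < c → c ≤ a + d → ¬ P c)
      last-before P a zero p = a , ≤-refl , ≤-reflexive (sym (+-identityʳ a)) , p ,
                               λ c a<c c≤ _ → <⇒≱ a<c (subst (c ≤_) (+-identityʳ a) c≤)
      last-before P a (suc d) p with em {P (a + suc d)}
      ... | yes q = a + suc d , m≤m+n a _ , ≤-refl , q , λ c b<c c≤ _ → <⇒≱ b<c c≤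
      ... | no ¬q with last-before P a d p
      ... | b , a≤b , b≤ , pb , none = b , a≤b , ≤-trans b≤ (+-monoʳ-≤ a (n≤1+n d)) , pb , none′
        where
        none′ : ∀ c → b < c → c ≤ a + suc d → ¬ P c
        none′ c b<c c≤ pc with m≤n⇒m<n∨m≡n c≤
        ... | inj₁ c<  = none c b<c (s≤s⁻¹ (subst (suc c ≤_) (+-suc a d) c<)) pc
        ... | inj₂ refl = ¬q pc

    -- From this length on, transport does not shorten a run: ℓ q + H ≤ L whenever
    -- n q ≤ L, because ℓ q + H ≤ L₀ if q ≤ H, while ℓ q + H ≤ n q if H ≤ q.
    L₀ : ℕ
    L₀ = suc ℓ * H

    fits₀ : ∀ {L} → L₀ ≤ L → ∀ q → n * q ≤ L → ℓ * q + H ≤ L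
    fits₀ {L} L₀≤L q nq≤L with ≤-total q H
    ... | inj₁ q≤H = ≤-trans (+-monoˡ-≤ H (*-monoʳ-≤ ℓ q≤H)) (≤-trans (≤-reflexive (+-comm (ℓ * H) H)) L₀≤L)
    ... | inj₂ H≤q = ≤-trans (+-monoʳ-≤ (ℓ * q) (≤-trans H≤q (m≤n*m q m)))
                       (≤-trans (≤-reflexive (trans (+-comm (ℓ * q) (m * q)) (sym (*-distribʳ-+ q m ℓ)))) nq≤L)

    abstract
      -- Suppose the gaps between starts of runs of A of length L were unbounded.  Let b be
      -- the last start before a gap longer than ℓ + m w, and ℓ v the first multiple of ℓ
      -- beyond b.  Then B has a run at n v, while no run of A starts at m w′ + ℓ v for
      -- w′ ≤ w, since these numbers lie in the gap.  A sequence of such v contradicts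
      -- Opposite.
      syndetic-runs : Long A → ∀ L → L₀ ≤ L → Syndetic (Run A L)
      syndetic-runs long L L₀≤L with em {Syndetic (Run A L)}
      ... | yes p = p
      ... | no ¬synd = ⊥-elim absurd
        where
        P : ℕ → ℕ → Set
        P w v = Run B L (n * v) × (∀ w′ → w′ ≤ w → ¬ Run A L (m * w′ + ℓ * v))

        step : ∀ w → ∃[ v ] w < v × P w v
        step w with long L (ℓ * (w + K))
        ... | a , a≥ , run-a with ¬∀⇒∃¬ (λ f → ¬synd (a + ℓ + m * w , f))
        ... | x , ¬run with ≤-total x a
        ... | inj₁ x≤a = ⊥-elim (¬run (a ∸ x , ≤-trans (m∸n≤m a x) (≤-trans (m≤m+n a ℓ) (m≤m+n _ (m * w))) ,
                                       subst (Run A L) (sym (m+[n∸m]≡n x≤a)) run-a))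
        ... | inj₂ a≤x with last-before (Run A L) a (x ∸ a) run-a
        ... | b , a≤b , b≤ , run-b , none with above ℓ b
        ... | v , b< , ≤b = v , ≤-<-trans (m≤m+n w K) big ,
                            transport b v (<⇒≤ b<) ≤b (≤-trans (m≤n+m K w) (<⇒≤ big)) (fits₀ L₀≤L) run-b ,
                            free
          where
          big : w + K < v
          big = above-big b< (≤-trans a≥ a≤b)
          b≤x : b ≤ x
          b≤x = subst (b ≤_) (m+[n∸m]≡n a≤x) b≤
          free : ∀ w′ → w′ ≤ w → ¬ Run A L (m * w′ + ℓ * v)
          free w′ w′≤w run with ≤-total (m * w′ + ℓ * v) x
          ... | inj₁ y≤x = none _ (<-≤-trans b< (m≤n+m _ (m * w′))) (subst (_ ≤_) (sym (m+[n∸m]≡n a≤x)) y≤x) run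
          ... | inj₂ x≤y = ¬run (_ , +-cancelˡ-≤ x _ _ (≤-trans (≤-reflexive (m+[n∸m]≡n x≤y)) bound) ,
                                 subst (Run A L) (sym (m+[n∸m]≡n x≤y)) run)
            where
            open ≤-Reasoning
            bound : m * w′ + ℓ * v ≤ x + (a + ℓ + m * w)
            bound = begin
              m * w′ + ℓ * v        ≤⟨ +-mono-≤ (*-monoʳ-≤ m w′≤w) (≤-trans ≤b (+-monoˡ-≤ ℓ b≤x)) ⟩
              m * w + (x + ℓ)       ≤⟨ m≤n+m _ a ⟩
              a + (m * w + (x + ℓ)) ≡⟨ re a (m * w) x ℓ ⟩
              x + (a + ℓ + m * w)   ∎
              where
              re : ∀ a b x ℓ → a + (b + (x + ℓ)) ≡ x + (a + ℓ + b)
              re = solve-∀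

        anti : ∀ {w w′ v} → w′ ≤ w → P w v → P w′ v
        anti w′≤w (run , none) = run , λ w″ w″≤ → none w″ (≤-trans w″≤ w′≤w)

        absurd : ⊥
        absurd with chain P anti step
        ... | v , inc , _ , pair with opp v inc L
        ... | i , k , i<k , same with pair i k i<k
        ... | run , none = none (v i) ≤-refl (λ e e≤L → proj₂ (same e e≤L) (run e e≤L))

    abstract
      -- Runs of A of length at least G recur with bounded gaps, so one of them shares an
      -- interval of length G with a sufficiently long run of B.
      no-overlap : ∀ G → (∀ y → ¬ (Run A G y × Run B G y)) → ¬ Long A
      no-overlap G disjoint long with syndetic-runs long (L₀ + G) (m≤m+n L₀ G)
      ... | G′ , synd with long-opposite long (G′ + G) 0
      ... | b , _ , run-B with synd b
      ... | t , t≤G′ , run-A =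
        disjoint (b + t) ((λ e e≤G → run-A e (≤-trans e≤G (m≤n+m G L₀))) ,
                          (λ e e≤G → subst B (sym (+-assoc b t e)) (run-B (t + e) (+-mono-≤ t≤G′ e≤G))))

-- Finite words

-- The first W letters of f.
word : ∀ W → (ℕ → Bool) → Vec Bool W
word zero    f = []
word (suc W) f = f 0 ∷ word W (f ∘ suc)

word-cong : ∀ W {f g : ℕ → Bool} → (∀ e → e < W → f e ≡ g e) → word W f ≡ word W g
word-cong zero    eq = refl
word-cong (suc W) eq = cong₂ _∷_ (eq 0 (s≤s z≤n)) (word-cong W λ e e<W → eq (suc e) (s≤s e<W))

word-injective : ∀ W {f g : ℕ → Bool} → word W f ≡ word W g → ∀ e → e < W → f e ≡ g e
word-injective (suc W) eq zero    _   = ∷-injectiveˡ eq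
word-injective (suc W) eq (suc e) e<W = word-injective W (∷-injectiveʳ eq) e (s≤s⁻¹ e<W)

words : ∀ W → List (Vec Bool W)
words zero    = [] ∷ []
words (suc W) = map (true ∷_) (words W) ++ map (false ∷_) (words W)

words-complete : ∀ {W} (w : Vec Bool W) → w List.∈ words W
words-complete []          = here refl
words-complete (true ∷ w)  = ∈-++⁺ˡ (∈-map⁺ (true ∷_) (words-complete w))
words-complete (false ∷ w) = ∈-++⁺ʳ _ (∈-map⁺ (false ∷_) (words-complete w))

-- Intervals on which all words recur

module LimitPatterns (em : ExcludedMiddle 0ℓ) (m ℓ : ℕ) .{{_ : NonZero m}} .{{_ : NonZero ℓ}} (κ : ℕ → Bool)
  (avoid : ∀ u → Increasing u → ∀ o c → (∀ k → κ ((m + ℓ) * u k + o) ≡ c) →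
           (∀ i k → i < k → κ (m * u i + ℓ * u k + o) ≡ c) → ⊥) where

  open Classical em
  open Averages em m ℓ κ avoid
  open Hindman em

  -- After dilation by c and translation by o, s and b have different colours.
  Negated : ℕ → ℕ → ℕ → ℕ → Set
  Negated c o s b = κ (c * s + o) ≡ not (κ (c * b + o))

  abstract
    -- The flips at one pair hold for the whole windows of length L around
    -- m (u i) + ℓ (u k) and n (u k), because c (s + e) + o = c s + (c e + o).
    windows : ∀ u → Increasing u → ∀ L W → ∃[ i ] ∃[ k ] i < k ×
      (∀ e → e ≤ L → ∀ o → o < W → Negated ℓ o (m * u i + ℓ * u k + e) (n * u k + e) ×
                                   Negated m o (m * u i + ℓ * u k + e) (n * u k + e) ×
                                   Negated n o (m * u i + ℓ * u k + e) (n * u k + e))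
    windows u inc L W with flips u inc ((ℓ + m + n) * L + W)
    ... | i , k , i<k , f = i , k , i<k , λ e e≤L o o<W →
      let g : ∀ c → c ≤ ℓ + m + n → c * e + o < (ℓ + m + n) * L + W
          g c c≤ = +-mono-≤-< (*-mono-≤ c≤ e≤L) o<W
      in shift′ ℓ (proj₁ (f _ (g ℓ (≤-trans (m≤m+n ℓ m) (m≤m+n _ n))))) ,
         shift′ m (proj₁ (proj₂ (f _ (g m (≤-trans (m≤n+m m ℓ) (m≤m+n _ n)))))) ,
         shift′ n (proj₂ (proj₂ (f _ (g n (m≤n+m n (ℓ + m))))))
      where
      assoc : ∀ c s e o → c * s + (c * e + o) ≡ c * (s + e) + o
      assoc = solve-∀
      shift′ : ∀ c {s b e o} → κ (c * s + (c * e + o)) ≡ not (κ (c * b + (c * e + o))) →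
               Negated c o (s + e) (b + e)
      shift′ c {s} {b} {e} {o} = subst₂ (λ x y → κ x ≡ not (κ y)) (assoc c s e o) (assoc c b e o)

  -- The letters of κ from position ℓ y on.
  at : ℕ → ℕ → Bool
  at y e = κ (ℓ * y + e)

  -- The first W letters of V occur in κ with bounded gaps at multiples of ℓ.
  Syn : ℕ → (ℕ → Bool) → Set
  Syn W V = Syndetic (λ y → ∀ e → e < W → at y e ≡ V e)

  module _ (W : ℕ) where

    -- The same for a single word.
    SynWord : Vec Bool W → Set
    SynWord w = Syndetic (λ y → word W (at y) ≡ w)

    -- If the initial word of V belongs to ws, it occurs in κ with bounded gaps.
    Kept : List (Vec Bool W) → (ℕ → Bool) → Set
    Kept ws V = ∀ w → w List.∈ ws → word W V ≡ w → SynWord w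

    kept-opposite : ∀ ws → Opposite (λ y → Kept ws (at y)) (λ y → Kept ws (not ∘ at y))
    kept-opposite ws u inc L with windows u inc L W
    ... | i , k , i<k , f = i , k , i<k , λ e e≤L →
      let eq = word-cong W (λ o o<W → proj₁ (f e e≤L o o<W))
      in (λ kept w w∈ p → kept w w∈ (trans eq p)) , (λ kept w w∈ p → kept w w∈ (trans (sym eq) p))

    -- Nonrecurring words can be excluded one at a time.  If excluding w destroyed the
    -- long runs, then in every long enough run for ws, and those recur with bounded
    -- gaps, some position would spell w; so w would recur after all.
    kept-long : ∀ ws → Long (λ y → Kept ws (at y))
    kept-long [] L N = N , ≤-refl , λ _ _ _ ()
    kept-long (w ∷ ws) with em {SynWord w}
    ... | yes syn = λ L N →
      let (a , N≤a , run) = kept-long ws L N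
      in a , N≤a , λ { e e≤L _ (here refl) _ → syn ; e e≤L w′ (there w′∈) → run e e≤L w′ w′∈ }
    ... | no ¬syn = byContradiction λ ¬long → ¬syn (syn ¬long)
      where
      A A′ B : ℕ → Set
      A  y = Kept ws (at y)
      B  y = Kept ws (not ∘ at y)
      A′ y = Kept (w ∷ ws) (at y)
      threshold : ℕ
      threshold = L₀ {A} {B} (kept-opposite ws)
      new : ∀ {y} → A y → ¬ A′ y → word W (at y) ≡ w
      new kept ¬kept = byContradiction λ ≢w → ¬kept λ { _ (here refl) eq → ⊥-elim (≢w eq)
                                                     ; w′ (there w′∈) → kept w′ w′∈ }
      syn : ¬ Long A′ → SynWord w
      syn ¬long with ¬∀⇒∃¬ ¬long
      ... | L , ¬1 with ¬∀⇒∃¬ ¬1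
      ... | N , ¬2 with syndetic-runs {A} {B} (kept-opposite ws) (kept-long ws) (threshold + L) (m≤m+n threshold L)
      ... | G , synd = N + G + L , λ x → find x (synd (x + N))
        where
        find : ∀ x → ∃[ t ] t ≤ G × Run A (threshold + L) (x + N + t) →
               ∃[ t ] t ≤ N + G + L × word W (at (x + t)) ≡ w
        find x (t , t≤G , run) with ¬∀⇒∃¬ (λ r → ¬2 (x + N + t , ≤-trans (m≤n+m N x) (m≤m+n (x + N) t) , r))
        ... | e , ¬3 with ¬→⇒× ¬3
        ... | e≤L , ¬A′ = N + t + e , +-mono-≤ (+-monoʳ-≤ N t≤G) e≤L ,
          subst (λ y → word W (at y) ≡ w) (re x N t e) (new (run e (≤-trans e≤L (m≤n+m L threshold))) ¬A′)
          where
          re : ∀ x N t e → x + N + t + e ≡ x + (N + t + e)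
          re = solve-∀

  abstract
    syn-long : ∀ W → Long (λ y → Syn W (at y))
    syn-long W L N with kept-long W (words W) L N
    ... | a , N≤a , run = a , N≤a , λ e e≤L →
      let (G , f) = run e e≤L _ (words-complete _) refl
      in G , λ x → let (t , t≤G , eq) = f x in t , t≤G , word-injective W eq

  -- A system of sums whose words recur

  -- The word of length k that κ spells from m (ℓ q) on recurs with bounded gaps.
  Good : ℕ → ℕ → Set
  Good k q = Syn k (λ e → κ (m * (ℓ * q) + e))

  good-pred : ∀ {k q} → Good (suc k) q → Good k q
  good-pred (G , f) = G , λ x → let (t , t≤G , eq) = f x in t , t≤G , λ e e<k → eq e (m≤n⇒m≤1+n e<k)

  abstract
    -- Some positive a is good, together with s + a for all s ≤ σ: take m a at the
    -- beginning of a long interval all of whose words recur.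
    good-interval : ∀ k σ → ∃[ a ] 0 < a × (∀ s → s ≤ σ → Good k (s + a))
    good-interval k σ with syn-long k (m * σ + m) 0
    ... | b , _ , run with above m b
    ... | a , b< , ≤b = a , *-cancelˡ-< m 0 a (≤-<-trans (≤-reflexive (*-zeroʳ m)) (≤-<-trans z≤n b<)) , good
      where
      swap : ∀ m ℓ s a → m * (ℓ * (s + a)) ≡ ℓ * (m * (s + a))
      swap = solve-∀
      good : ∀ s → s ≤ σ → Good k (s + a)
      good s s≤σ with subst (λ y → Syn k (at y)) (m+[n∸m]≡n lower) (run _ (+-cancelˡ-≤ b _ _ (≤-trans (≤-reflexive (m+[n∸m]≡n lower)) upper)))
        where
        lower : b ≤ m * (s + a)
        lower = ≤-trans (<⇒≤ b<) (*-monoʳ-≤ m (m≤n+m a s))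
        upper : m * (s + a) ≤ b + (m * σ + m)
        upper = begin
          m * (s + a)       ≡⟨ *-distribˡ-+ m s a ⟩
          m * s + m * a     ≤⟨ +-mono-≤ (*-monoʳ-≤ m s≤σ) ≤b ⟩
          m * σ + (b + m)   ≡⟨ re (m * σ) b m ⟩
          b + (m * σ + m)   ∎
          where
          open ≤-Reasoning
          re : ∀ x b m → x + (b + m) ≡ b + (x + m)
          re = solve-∀
      ... | G , f = G , λ x → let (t , t≤G , eq) = f x in
                        t , t≤G , λ e e<k → trans (eq e e<k) (cong (λ y → κ (y + e)) (sym (swap m ℓ s a)))

  gen : ℕ → ℕ → ℕ
  gen k σ = proj₁ (good-interval k σ)

  -- A sequence whose terms are chosen with room for the sums of the earlier ones: σ
  -- bounds these sums, and each term demands words one letter longer.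
  thick : ℕ → ℕ → ℕ → ℕ
  thick k σ zero    = gen k σ
  thick k σ (suc j) = thick (suc k) (σ + gen k σ) j

  thick-good : ∀ {b x} → FS b x → ∀ k σ → b ≡ thick k σ → ∀ p → p ≤ σ → Good k (p + x)
  thick-good head k σ refl p p≤σ = proj₂ (proj₂ (good-interval k σ)) p p≤σ
  thick-good {x = x} (skip q) k σ refl p p≤σ =
    good-pred {k} {p + x} (thick-good q (suc k) (σ + gen k σ) refl p (≤-trans p≤σ (m≤m+n σ _)))
  thick-good (add {x = x} q) k σ refl p p≤σ =
    subst (Good k) (+-assoc p (gen k σ) x)
      (good-pred {k} {p + gen k σ + x} (thick-good q (suc k) (σ + gen k σ) refl (p + gen k σ) (+-monoˡ-≤ _ p≤σ)))

  -- A sum p + x with x a finite sum of thick k σ exceeds this bound only if x uses a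
  -- term with index at least j, and then it is good for words of length j + k.
  bound : ℕ → ℕ → ℕ → ℕ
  bound zero    k σ = 0
  bound (suc j) k σ = (σ + gen k σ) + bound j (suc k) (σ + gen k σ)

  thick-bound : ∀ j {b x} → FS b x → ∀ k σ → b ≡ thick k σ → ∀ p → p ≤ σ →
                Good (j + k) (p + x) ⊎ p + x ≤ bound j k σ
  thick-bound zero    q k σ eq p p≤σ = inj₁ (thick-good q k σ eq p p≤σ)
  thick-bound (suc j) head k σ refl p p≤σ = inj₂ (≤-trans (+-monoˡ-≤ _ p≤σ) (m≤m+n _ _))
  thick-bound (suc j) {x = x} (skip q) k σ refl p p≤σ with thick-bound j q (suc k) _ refl p (≤-trans p≤σ (m≤m+n σ (gen k σ)))
  ... | inj₁ good = inj₁ (subst (λ i → Good i (p + x)) (+-suc j k) good)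
  ... | inj₂ le   = inj₂ (≤-trans le (m≤n+m _ _))
  thick-bound (suc j) (add {x = x} q) k σ refl p p≤σ with thick-bound j q (suc k) _ refl (p + gen k σ) (+-monoˡ-≤ _ p≤σ)
  ... | inj₁ good = inj₁ (subst₂ Good (+-suc j k) (+-assoc p (gen k σ) x) good)
  ... | inj₂ le   = inj₂ (≤-trans (≤-reflexive (sym (+-assoc p (gen k σ) x))) (≤-trans le (m≤n+m _ _)))

  base : ℕ → ℕ
  base = thick 0 0

  base-good : ∀ W {x} → FS base x → bound W 0 0 < x → Good W x
  base-good W {x} q lt with thick-bound W q 0 0 refl 0 z≤n
  ... | inj₁ good = subst (λ i → Good i x) (+-identityʳ W) good
  ... | inj₂ le   = ⊥-elim (<⇒≱ lt le)

  thick-positive : ∀ {b x} → FS b x → ∀ k σ → b ≡ thick k σ → 0 < x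
  thick-positive head k σ refl = proj₁ (proj₂ (good-interval k σ))
  thick-positive (skip q) k σ refl = thick-positive q _ _ refl
  thick-positive (add q) k σ refl = ≤-trans (proj₁ (proj₂ (good-interval k σ))) (m≤m+n _ _)

  abstract
    -- A system of positive numbers has arbitrarily large sums y, each with a tail of
    -- the system whose sums may be added to y.
    large : ∀ {t} → (∀ {x} → FS t x → 0 < x) → ∀ N →
            ∃[ y ] FS t y × N ≤ y × (∃[ t′ ] ∀ {x} → FS t′ x → FS t x × FS t (y + x))
    large {t} pos zero = t 0 , head , z≤n , after head
    large {t} pos (suc N) with large pos N
    ... | y , y∈ , N≤y , t′ , sub =
      y + t′ 0 , proj₂ (sub head) ,
      ≤-trans (≤-reflexive (+-comm 1 N)) (+-mono-≤ N≤y (pos (proj₁ (sub head)))) ,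
      t′ ∘ suc , λ {x} q → proj₁ (sub (skip q)) , subst (FS t) (sym (+-assoc y (t′ 0) x)) (proj₂ (sub (add q)))

  -- Limit patterns

  -- The letter at offset e of the word spelled from c (ℓ q) on.
  local : ℕ → ℕ → ℕ → Bool
  local c e q = κ (c * (ℓ * q) + e)

  Homogeneous : ℕ → ℕ → Bool → (ℕ → ℕ) → Set
  Homogeneous c e b t = ∀ {q} → FS t q → local c e q ≡ b

  -- One stage of the diagonalisation, for the letters at offset e: a subsystem mono
  -- of t on whose sums these letters are constant for the dilations ℓ, m and n, a
  -- sum element of it that is at least N, and a system rest whose sums, with or
  -- without element added, are sums of mono.
  record Selection (e N : ℕ) (t : ℕ → ℕ) : Set where
    no-eta-equality
    field
      colourℓ colourₘ colourₙ : Bool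
      mono : ℕ → ℕ
      mono⊑ : mono ⊑ t
      constℓ : Homogeneous ℓ e colourℓ mono
      constₘ : Homogeneous m e colourₘ mono
      constₙ : Homogeneous n e colourₙ mono
      element : ℕ
      element∈ : FS mono element
      N≤element : N ≤ element
      rest : ℕ → ℕ
      rest⊑ : rest ⊑ mono
      shift⊑ : ∀ {x} → FS rest x → FS mono (element + x)

  abstract
    select : ∀ e N t → t ⊑ base → Selection e N t
    select e N t t⊑ with hindman (local ℓ e) t
    ... | c₁ , t₁ , sub₁ , h₁ with hindman (local m e) t₁
    ... | c₂ , t₂ , sub₂ , h₂ with hindman (local n e) t₂
    ... | c₃ , t₃ , sub₃ , h₃ with large {t₃} (λ q → thick-positive (t⊑ (sub₁ (sub₂ (sub₃ q)))) 0 0 refl) N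
    ... | y , y∈ , N≤y , t′ , sub′ = record
      { colourℓ = c₁ ; colourₘ = c₂ ; colourₙ = c₃ ; mono = t₃
      ; mono⊑ = sub₁ ∘ sub₂ ∘ sub₃
      ; constℓ = h₁ ∘ sub₂ ∘ sub₃ ; constₘ = h₂ ∘ sub₃ ; constₙ = h₃
      ; element = y ; element∈ = y∈ ; N≤element = N≤y
      ; rest = t′ ; rest⊑ = proj₁ ∘ sub′ ; shift⊑ = proj₂ ∘ sub′ }

  open Selection

  -- Large enough for the chosen sum to be good for words of length e and to exceed
  -- e.
  least : ℕ → ℕ
  least e = e + suc (bound e 0 0)

  system : ℕ → Σ (ℕ → ℕ) (_⊑ base)
  selection : ∀ e → Selection e (least e) (proj₁ (system e))
  system zero    = base , id
  system (suc e) = rest (selection e) , λ q → proj₂ (system e) (mono⊑ (selection e) (rest⊑ (selection e) q))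
  selection e = select e (least e) (proj₁ (system e)) (proj₂ (system e))

  system⊑ : ∀ e d → proj₁ (system (d + e)) ⊑ proj₁ (system e)
  system⊑ e zero    q = q
  system⊑ e (suc d) q = system⊑ e d (mono⊑ (selection (d + e)) (rest⊑ (selection (d + e)) q))

  q : ℕ → ℕ
  q e = element (selection e)

  mono⊑mono : ∀ {e i} → e ≤ i → ∀ {x} → FS (mono (selection i)) x → FS (mono (selection e)) x
  mono⊑mono {e} {i} e≤i {x} p with m≤n⇒m<n∨m≡n e≤i
  ... | inj₂ refl = p
  ... | inj₁ e<i = rest⊑ (selection e) (system⊑ (suc e) (i ∸ suc e)
                     (subst (λ j → FS (proj₁ (system j)) x) (sym (m∸n+n≡m e<i)) (mono⊑ (selection i) p)))

  q∈ : ∀ {e i} → e ≤ i → FS (mono (selection e)) (q i)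
  q∈ {e} {i} e≤i = mono⊑mono e≤i (element∈ (selection i))

  q+q∈ : ∀ {e i k} → e ≤ i → i < k → FS (mono (selection e)) (q i + q k)
  q+q∈ {e} {i} {k} e≤i i<k = mono⊑mono e≤i (shift⊑ (selection i)
    (system⊑ (suc i) (k ∸ suc i) (subst (λ j → FS (proj₁ (system j)) (q k)) (sym (m∸n+n≡m i<k))
      (mono⊑ (selection k) (element∈ (selection k))))))

  -- The limits of κ read from ℓ (y i), m (y i) and n (y i) on; the letter at offset e
  -- is final from i = e on.
  X Z U : ℕ → Bool
  X e = colourℓ (selection e)
  Z e = colourₘ (selection e)
  U e = colourₙ (selection e)

  y : ℕ → ℕ
  y i = ℓ * q i

  i≤y : ∀ i → i ≤ y i
  i≤y i = ≤-trans (m≤m+n i _) (≤-trans (N≤element (selection i)) (m≤n*m (q i) ℓ))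

  X-limit : ∀ {e i} → e ≤ i → κ (ℓ * y i + e) ≡ X e
  X-limit {e} e≤i = constℓ (selection e) (q∈ e≤i)

  Z-limit : ∀ {e i} → e ≤ i → κ (m * y i + e) ≡ Z e
  Z-limit {e} e≤i = constₘ (selection e) (q∈ e≤i)

  U-limit : ∀ {e i} → e ≤ i → κ (n * y i + e) ≡ U e
  U-limit {e} e≤i = constₙ (selection e) (q∈ e≤i)

  abstract
    -- For k far beyond i the left side is κ (m (y k) + m (y i) + e), the letter at
    -- offset e from m ℓ (q i + q k) on, and q i + q k is a sum of the system on which
    -- this letter is constant.
    Z-recurrent : ∀ {e i} → e ≤ i → Z (m * y i + e) ≡ Z e
    Z-recurrent {e} {i} e≤i = begin
      Z (m * y i + e)                    ≡⟨ sym (Z-limit {m * y i + e} {k} (m≤n⇒m≤1+n (m≤m+n _ i))) ⟩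
      κ (m * y k + (m * y i + e))        ≡⟨ cong κ (re m ℓ (q i) (q k) e) ⟩
      κ (m * (ℓ * (q i + q k)) + e)      ≡⟨ constₘ (selection e) (q+q∈ {e} {i} {k} e≤i (s≤s (m≤n+m i (m * y i + e)))) ⟩
      Z e                                ∎
      where
      open ≡-Reasoning
      k : ℕ
      k = suc (m * y i + e + i)
      re : ∀ m ℓ a b e → m * (ℓ * b) + (m * (ℓ * a) + e) ≡ m * (ℓ * (a + b)) + e
      re = solve-∀

    Z-syn : ∀ W → Syn W Z
    Z-syn W with base-good W {q W} (proj₂ (system W) (mono⊑ (selection W) (element∈ (selection W))))
                   (≤-trans (m≤n+m _ W) (N≤element (selection W)))
    ... | G , f = G , λ x → let (t , t≤G , eq) = f x in
                  t , t≤G , λ e e<W → trans (eq e e<W) (Z-limit (<⇒≤ e<W))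

  -- The rule relating limit patterns

  -- If the first W letters of f are those of Z, then a is opposite to b; if they are
  -- those of the negation of Z (ε = true), then a is equal to b.
  record Rule (W : ℕ) (f : ℕ → Bool) (a b : Bool) : Set where
    constructor mkRule
    field
      obey : ∀ ε → (∀ e → e < W → f e ≡ ε xor Z e) → a ≡ not (ε xor b)

  open Rule

  -- The rule for the limit patterns, with the word of X at ℓ t, the letter of U at n t
  -- and the letter of Z at m t.
  Ruled : ℕ → Bool → Set
  Ruled W ε = ∀ t → (∀ e → e < W → X (ℓ * t + e) ≡ ε xor Z e) → U (n * t) ≡ not (ε xor Z (m * t))

  abstract
    -- For a counterexample t with W > m w, the number v = t + y i with i large has
    -- κ (m w′ + ℓ v) = ε xor Z (m w′) for w′ ≤ w by the limit X, and
    -- κ (n v) = ε xor Z (m v) by the limit U and the recurrence of Z.  Along a sequence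
    -- of such v the colour of m (v i) + ℓ (v k) is that of n (v i).
    ruled : ∀ ε → ∃[ W ] Ruled W ε
    ruled ε = byContradiction λ ¬ruled → absurd λ W → ¬∀⇒∃¬ λ r → ¬ruled (W , r)
      where
      P : ℕ → ℕ → Set
      P w v = (∀ w′ → w′ ≤ w → κ (m * w′ + ℓ * v) ≡ ε xor Z (m * w′)) × κ (n * v) ≡ ε xor Z (m * v)

      anti : ∀ {w w′ v} → w′ ≤ w → P w v → P w′ v
      anti w′≤w (f , g) = (λ w″ w″≤ → f w″ (≤-trans w″≤ w′≤w)) , g

      absurd : (∀ W → ∃[ t ] ¬ ((∀ e → e < W → X (ℓ * t + e) ≡ ε xor Z e) → U (n * t) ≡ not (ε xor Z (m * t)))) → ⊥
      absurd violated = conclude (chain P anti step)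
        where
        step : ∀ w → ∃[ v ] w < v × P w v
        step w with violated (suc (m * w))
        ... | t , ¬1 with ¬→⇒× ¬1
        ... | near , ¬2 = t + y i , ≤-trans (≤-trans w<i (i≤y i)) (m≤n+m (y i) t) , left , right
          where
          -- Larger than w, and than every offset at which a limit or the recurrence of Z is
          -- used.
          i : ℕ
          i = suc w + (n * t + m * t + (ℓ * t + m * w))
          w<i : w < i
          w<i = m≤m+n (suc w) _
          left : ∀ w′ → w′ ≤ w → κ (m * w′ + ℓ * (t + y i)) ≡ ε xor Z (m * w′)
          left w′ w′≤w = begin
            κ (m * w′ + ℓ * (t + y i))       ≡⟨ cong κ (re m ℓ w′ t (y i)) ⟩
            κ (ℓ * y i + (ℓ * t + m * w′))   ≡⟨ X-limit (≤-trans (+-monoʳ-≤ (ℓ * t) (*-monoʳ-≤ m w′≤w)) (≤-trans (m≤n+m _ (n * t + m * t)) (m≤n+m _ (suc w)))) ⟩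
            X (ℓ * t + m * w′)               ≡⟨ near (m * w′) (s≤s (*-monoʳ-≤ m w′≤w)) ⟩
            ε xor Z (m * w′)                 ∎
            where
            open ≡-Reasoning
            re : ∀ m ℓ w t y → m * w + ℓ * (t + y) ≡ ℓ * y + (ℓ * t + m * w)
            re = solve-∀
          re : ∀ c t y → c * (t + y) ≡ c * y + c * t
          re = solve-∀
          right : κ (n * (t + y i)) ≡ ε xor Z (m * (t + y i))
          right = begin
            κ (n * (t + y i))                ≡⟨ cong κ (re n t (y i)) ⟩
            κ (n * y i + n * t)              ≡⟨ U-limit (≤-trans (m≤m+n (n * t) (m * t)) (≤-trans (m≤m+n _ _) (m≤n+m _ (suc w)))) ⟩
            U (n * t)                        ≡⟨ trans (¬-not ¬2) (not-involutive _) ⟩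
            ε xor Z (m * t)                  ≡⟨ cong (ε xor_) (sym (Z-recurrent (≤-trans (m≤n+m (m * t) (n * t)) (≤-trans (m≤m+n _ _) (m≤n+m _ (suc w)))))) ⟩
            ε xor Z (m * y i + m * t)        ≡⟨ cong (λ x → ε xor Z x) (sym (re m t (y i))) ⟩
            ε xor Z (m * (t + y i))          ∎
            where open ≡-Reasoning
        conclude : ∃[ v ] Increasing v × (∀ k → P 0 (v k)) × (∀ i k → i < k → P (v i) (v k)) → ⊥
        conclude (v , inc , own , pair) with pigeonhole (λ k → κ (n * v k))
        ... | c , φ , incφ , const =
          avoid (v ∘ φ) (increasing-∘ inc incφ) 0 c
            (λ k → trans (cong κ (+-identityʳ _)) (const k))
            (λ i k i<k → trans (cong κ (+-identityʳ _))
              (trans (proj₁ (pair _ _ (increasing-< incφ i<k)) (v (φ i)) ≤-refl)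
                (trans (sym (proj₂ (own (φ i)))) (const i))))

  -- One word length serves both signs.
  width : ℕ
  width = proj₁ (ruled false) + proj₁ (ruled true)

  rule : ∀ ε → Ruled width ε
  rule false t near = proj₂ (ruled false) t λ e e< → near e (≤-trans e< (m≤m+n _ _))
  rule true  t near = proj₂ (ruled true)  t λ e e< → near e (≤-trans e< (m≤n+m _ _))

  -- The rule for the letters of a colouring g at the position y.
  RuleAt : (ℕ → Bool) → ℕ → Set
  RuleAt g y = Rule width (λ e → g (ℓ * y + e)) (g (n * y + 0)) (g (m * y + 0))

  Rule-resp : ∀ {W f f′ a a′ b b′} → (∀ e → e < W → f e ≡ f′ e) → a ≡ a′ → b ≡ b′ →
              Rule W f a b → Rule W f′ a′ b′
  Rule-resp f≡ refl refl r = mkRule λ ε near → obey r ε λ e e<W → trans (f≡ e e<W) (near e e<W)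

  rule-negated : ∀ {s b} → (∀ o → o < width → Negated ℓ o s b) → Negated m 0 s b → Negated n 0 s b →
                 (RuleAt κ s → RuleAt (not ∘ κ) b) × (RuleAt (not ∘ κ) b → RuleAt κ s)
  rule-negated {s} {b} fℓ fm fn =
    Rule-resp {width} {λ e → κ (ℓ * s + e)} {λ e → not (κ (ℓ * b + e))} fℓ fn fm ,
    Rule-resp {width} {λ e → not (κ (ℓ * b + e))} {λ e → κ (ℓ * s + e)} (λ o o< → sym (fℓ o o<)) (sym fn) (sym fm)

  abstract
    rule-opposite : Opposite (RuleAt κ) (RuleAt (not ∘ κ))
    rule-opposite u inc L =
      let (i , k , i<k , f) = windows u inc L (suc width)
      in i , k , i<k , λ e e≤L →
         rule-negated {m * u i + ℓ * u k + e} {n * u k + e} (λ o o< → proj₁ (f e e≤L o (m≤n⇒m≤1+n o<)))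
           (proj₁ (proj₂ (f e e≤L 0 (s≤s z≤n)))) (proj₂ (proj₂ (f e e≤L 0 (s≤s z≤n))))

    -- Near ℓ (y i), m (y i) and n (y i) the colouring κ coincides with its limits.
    rule-long : Long (RuleAt κ)
    rule-long L N = y i , ≤-trans (m≤m+n N _) (i≤y i) , λ e e≤L → here′ e e≤L
      where
      i : ℕ
      i = N + (n * L + m * L + (ℓ * L + width))
      re : ∀ c y t o → c * y + (c * t + o) ≡ c * (y + t) + o
      re = solve-∀
      b₀ : n * L + m * L ≤ i
      b₀ = ≤-trans (m≤m+n _ _) (m≤n+m _ N)
      here′ : ∀ e → e ≤ L → RuleAt κ (y i + e)
      here′ e e≤L = Rule-resp
        (λ o o< → trans (sym (X-limit (≤-trans (+-mono-≤ (*-monoʳ-≤ ℓ e≤L) (<⇒≤ o<)) (≤-trans (m≤n+m _ (n * L + m * L)) (m≤n+m _ N)))))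
                    (cong κ (re ℓ (y i) e o)))
        (trans (sym (U-limit (≤-trans (*-monoʳ-≤ n e≤L) (≤-trans (m≤m+n _ (m * L)) b₀)))) (cong κ (re₀ n e)))
        (trans (sym (Z-limit (≤-trans (*-monoʳ-≤ m e≤L) (≤-trans (m≤n+m _ (n * L)) b₀)))) (cong κ (re₀ m e)))
        (mkRule λ ε near → rule ε e near)
        where
        re₀ : ∀ c e → c * y i + c * e ≡ c * (y i + e) + 0
        re₀ c e = trans (cong (c * y i +_) (sym (+-identityʳ (c * e)))) (re c (y i) e 0)

  rule-clash : ∀ y → (∀ e → e < width → at y e ≡ Z e) → RuleAt κ y → RuleAt (not ∘ κ) y → ⊥
  rule-clash y eq r r′ =
    not-¬ (obey r false eq)
      (trans (sym (not-involutive _)) (trans (cong not (obey r′ true λ e e< → cong not (eq e e<)))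
        (not-involutive _)))

  contradictory : ⊥
  contradictory =
    let (G , f) = Z-syn width
    in no-overlap {RuleAt κ} {RuleAt (not ∘ κ)} rule-opposite G
         (λ x (runA , runB) → let (t , t≤G , eq) = f x in rule-clash (x + t) eq (runA t t≤G) (runB t t≤G))
         rule-long

-- Back to the original colouring

module _ (em : ExcludedMiddle 0ℓ) (m ℓ : ℕ) .{{_ : NonZero m}} .{{_ : NonZero ℓ}} (χ : ℕ → Bool) where

  -- An increasing sequence of positive numbers whose range is a monochromatic B.
  Solution : Set
  Solution = ∃[ c ] ∃[ u ] Increasing u × 0 < u 0 × (∀ k → χ ((m + ℓ) * u k) ≡ c) ×
             (∀ i k → i < k → χ (m * u i + ℓ * u k) ≡ c)

  solution : Solution
  solution with em {Solution}
  ... | yes s = s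
  ... | no ¬s = ⊥-elim (LimitPatterns.contradictory em m ℓ (λ x → χ ((m + ℓ) * x)) avoid)
    where
    n : ℕ
    n = m + ℓ
    instance
      n≢0 : NonZero n
      n≢0 = >-nonZero (<-≤-trans (>-nonZero⁻¹ m) (m≤m+n m ℓ))
    avoid : ∀ u → Increasing u → ∀ o c → (∀ k → χ (n * (n * u k + o)) ≡ c) →
            (∀ i k → i < k → χ (n * (m * u i + ℓ * u k + o)) ≡ c) → ⊥
    avoid u inc o c const sums =
      ¬s (c , v , (λ k → +-monoˡ-< o (*-monoʳ-< n (inc (suc k)))) ,
          <-≤-trans (<-≤-trans (≤-<-trans z≤n (inc 0)) (m≤n*m (u 1) n)) (m≤m+n _ o) ,
          (λ k → const (suc k)) ,
          λ i k i<k → trans (cong χ (re m ℓ (u (suc i)) (u (suc k)) o)) (sums (suc i) (suc k) (s≤s i<k)))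
      where
      -- The index is shifted because v 0 has to be positive.
      v : ℕ → ℕ
      v k = n * u (suc k) + o
      re : ∀ m ℓ x y o → m * ((m + ℓ) * x + o) + ℓ * ((m + ℓ) * y + o) ≡ (m + ℓ) * (m * x + ℓ * y + o)
      re = solve-∀

theorem1p6 : ExcludedMiddle 0ℓ →
    (m ℓ : ℕ) → m ∈ ℕ⁺ → ℓ ∈ ℕ⁺ →
    (C : Fin 2 → Pred ℕ 0ℓ) → IsPartition C →
    ∃[ i ] ∃[ B ] B ⊆ ℕ⁺ × Inf B × ((m + ℓ) · B ∪ OrderedSums m ℓ B) ⊆ C i
theorem1p6 em m ℓ 0<m 0<ℓ C ((_ , cover) , _) =
  let (c , u , inc , pos , dil , sums) = solution em m ℓ {{>-nonZero 0<m}} {{>-nonZero 0<ℓ}} χ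
      B = λ x → ∃[ k ] x ≡ u k
      0<u = λ k → <-≤-trans pos (increasing-≤ inc z≤n)
  in colour c , B , (λ { (k , refl) → 0<u k }) ,
     (λ { (N , none) → none (u N) (increasing-id≤ inc N) (N , refl) }) ,
     λ { (inj₁ (_ , (k , refl) , refl)) → inside c (dil k) (≤-trans (0<u k) (m≤n*m (u k) (m + ℓ) {{n≢0}}))
       ; (inj₂ (_ , _ , (i , refl) , (k , refl) , ui<uk , refl)) →
           inside c (sums i k (reflect inc ui<uk))
             (≤-trans (0<u k) (≤-trans (m≤n*m (u k) ℓ {{>-nonZero 0<ℓ}}) (m≤n+m (ℓ * u k) (m * u i)))) }
  where
  n≢0 : NonZero (m + ℓ)
  n≢0 = >-nonZero (<-≤-trans 0<m (m≤m+n m ℓ))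
  χ : ℕ → Bool
  χ x = does (em {C zero x})
  colour : Bool → Fin 2
  colour true  = zero
  colour false = suc zero
  inside : ∀ c {x} → χ x ≡ c → 0 < x → C (colour c) x
  inside c {x} eq 0<x with em {C zero x}
  inside true  refl 0<x | yes x∈ = x∈
  inside false refl 0<x | no x∉ with cover 0<x
  ... | inj₁ x∈ = ⊥-elim (x∉ x∈)
  ... | inj₂ x∈ = x∈
  reflect : ∀ {u} → Increasing u → ∀ {i k} → u i < u k → i < k
  reflect inc {i} {k} lt = ≰⇒> λ k≤i → <⇒≱ lt (increasing-≤ inc k≤i)
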